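{- Every non-trivial continuous algebra is a subdirect product of a family of continuous chains.
   Context: A continuous algebra is a tuple $(A,\oplus,\neg,\bar 0,\kappa)$, where $\oplus$ is a binary operation on $A$, $\bar 0\in A$, and $\neg,\kappa$ are unary operations on $A$, such that for all $x,y,z\in A$: (C1) $x\oplus(y\oplus z)=(x\oplus y)\oplus z$; (C2) $x\oplus y=y\oplus x$; (C3) $x\oplus\bar 0=x$; (C4) $\neg\neg x=x$; (C5) $x\oplus\neg\bar 0=\neg\bar 0$; (C6) $\neg(\neg x\oplus y)\oplus y=\neg(\neg y\oplus x)\oplus x$; (C7) $\kappa x=x\oplus\neg\kappa x$; (C8) $(\neg\kappa x\oplus\kappa y)\oplus\neg(\neg x\oplus y)=\neg\bar 0$. Write $\bar 1=\neg\bar 0$. Non-trivial means having more than one element. The order on $A$ is: $x\le y$ iff $\neg x\oplus y=\bar 1$. A continuous chain is a continuous algebra that is totally ordered by $\le$. A continuous homomorphism is a map between continuous algebras preserving $\bar 0,\oplus,\neg,\kappa$. The product $\prod_{i\in I}\mathscr{A}_i$ of a family of continuous algebras indexed by a non-empty set $I$ is the Cartesian product with componentwise operations; $\pi_j$ denotes the $j$-th projection. A continuous algebra $\mathscr{A}$ is a subdirect product of a family $\{\mathscr{A}_i\}_{i\in I}$ of continuous algebras ($I\neq\emptyset$) if there exists an injective continuous homomorphism $h:A\to\prod_{i\in I}A_i$ such that $\pi_j\circ h$ is surjective for all $j\in I$. -}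

module Defs where

open import Level using (Level; _⊔_; suc)
open import Algebra.Core using (Op₁; Op₂)
open import Algebra.Definitions using (Congruent₁; Congruent₂)
import Algebra.Morphism.Definitions as MorphismDefinitions
open import Data.Product using (∃; ∃₂)
open import Data.Sum using (_⊎_)
open import Function using (_∘_)
open import Function.Definitions using (Congruent; Injective; Surjective)
open import Relation.Binary.Core using (Rel)
open import Relation.Binary.Bundles using (Poset)
open import Relation.Binary.Structures using (IsEquivalence; IsTotalOrder)
open import Relation.Nullary using (¬_)
open import Relation.Unary using (Pred)

-- As in Algebra.Bundles, the equality of an algebra is an equivalence relation
-- _≈_ respected by all operations.  The operation ¬ is written ∼_ because ¬_
-- is logical negation.
record ContinuousAlgebra (c ℓ : Level) : Set (suc (c ⊔ ℓ)) where
  infix  8 ∼_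
  infixl 6 _⊕_
  infix  4 _≈_ _≤_
  field
    Carrier       : Set c
    _≈_           : Rel Carrier ℓ
    _⊕_           : Op₂ Carrier
    ∼_            : Op₁ Carrier
    0#            : Carrier
    κ             : Op₁ Carrier
    isEquivalence : IsEquivalence _≈_
    ⊕-cong        : Congruent₂ _≈_ _⊕_
    ∼-cong        : Congruent₁ _≈_ ∼_
    κ-cong        : Congruent₁ _≈_ κ
    C1            : ∀ x y z → x ⊕ (y ⊕ z) ≈ (x ⊕ y) ⊕ z
    C2            : ∀ x y → x ⊕ y ≈ y ⊕ x
    C3            : ∀ x → x ⊕ 0# ≈ x
    C4            : ∀ x → ∼ (∼ x) ≈ x
    C5            : ∀ x → x ⊕ ∼ 0# ≈ ∼ 0#
    C6            : ∀ x y → ∼ (∼ x ⊕ y) ⊕ y ≈ ∼ (∼ y ⊕ x) ⊕ x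
    C7            : ∀ x → κ x ≈ x ⊕ ∼ (κ x)
    C8            : ∀ x y → (∼ (κ x) ⊕ κ y) ⊕ ∼ (∼ x ⊕ y) ≈ ∼ 0#

  1# : Carrier
  1# = ∼ 0#

  _≤_ : Rel Carrier ℓ
  x ≤ y = ∼ x ⊕ y ≈ 1#

module _ {c ℓ : Level} (𝓐 : ContinuousAlgebra c ℓ) where
  open ContinuousAlgebra 𝓐

  NonTrivial : Set (c ⊔ ℓ)
  NonTrivial = ∃₂ λ x y → ¬ (x ≈ y)

  IsChain : Set (c ⊔ ℓ)
  IsChain = IsTotalOrder _≈_ _≤_

module _ {c₁ ℓ₁ c₂ ℓ₂ : Level}
         (𝓐 : ContinuousAlgebra c₁ ℓ₁) (𝓑 : ContinuousAlgebra c₂ ℓ₂) where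
  private
    module A = ContinuousAlgebra 𝓐
    module B = ContinuousAlgebra 𝓑
  open MorphismDefinitions A.Carrier B.Carrier B._≈_

  record IsContinuousHomomorphism (h : A.Carrier → B.Carrier)
         : Set (c₁ ⊔ ℓ₁ ⊔ ℓ₂) where
    field
      cong   : Congruent A._≈_ B._≈_ h
      0-homo : Homomorphic₀ h A.0# B.0#
      ⊕-homo : Homomorphic₂ h A._⊕_ B._⊕_
      ∼-homo : Homomorphic₁ h A.∼_ B.∼_
      κ-homo : Homomorphic₁ h A.κ B.κ

module _ {i c ℓ : Level} {I : Set i} (𝓐 : I → ContinuousAlgebra c ℓ) where
  private
    module A (j : I) = ContinuousAlgebra (𝓐 j)
    module E (j : I) = IsEquivalence (A.isEquivalence j)

  ∏ : ContinuousAlgebra (i ⊔ c) (i ⊔ ℓ)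
  ∏ = record
    { Carrier       = ∀ j → A.Carrier j
    ; _≈_           = λ x y → ∀ j → A._≈_ j (x j) (y j)
    ; _⊕_           = λ x y j → A._⊕_ j (x j) (y j)
    ; ∼_            = λ x j → A.∼_ j (x j)
    ; 0#            = λ j → A.0# j
    ; κ             = λ x j → A.κ j (x j)
    ; isEquivalence = record
      { refl  = λ j → E.refl j
      ; sym   = λ p j → E.sym j (p j)
      ; trans = λ p q j → E.trans j (p j) (q j)
      }
    ; ⊕-cong        = λ p q j → A.⊕-cong j (p j) (q j)
    ; ∼-cong        = λ p j → A.∼-cong j (p j)
    ; κ-cong        = λ p j → A.κ-cong j (p j)
    ; C1            = λ x y z j → A.C1 j (x j) (y j) (z j)
    ; C2            = λ x y j → A.C2 j (x j) (y j)
    ; C3            = λ x j → A.C3 j (x j)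
    ; C4            = λ x j → A.C4 j (x j)
    ; C5            = λ x j → A.C5 j (x j)
    ; C6            = λ x y j → A.C6 j (x j) (y j)
    ; C7            = λ x j → A.C7 j (x j)
    ; C8            = λ x y j → A.C8 j (x j) (y j)
    }

  π : ∀ j → ContinuousAlgebra.Carrier ∏ → A.Carrier j
  π j x = x j

record IsSubdirectProduct {c ℓ i c′ ℓ′ : Level} (𝓐 : ContinuousAlgebra c ℓ)
       {I : Set i} (𝓑 : I → ContinuousAlgebra c′ ℓ′)
       : Set (c ⊔ ℓ ⊔ i ⊔ c′ ⊔ ℓ′) where
  private
    module A   = ContinuousAlgebra 𝓐
    module P   = ContinuousAlgebra (∏ 𝓑)
    module B j = ContinuousAlgebra (𝓑 j)
  field
    nonEmpty       : I
    h              : A.Carrier → P.Carrier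
    isHomomorphism : IsContinuousHomomorphism 𝓐 (∏ 𝓑) h
    injective      : Injective A._≈_ P._≈_ h
    surjective     : ∀ j → Surjective A._≈_ (B._≈_ j) (π 𝓑 j ∘ h)

-- The empty chain is allowed, so the hypothesis forces the poset to be
-- inhabited.
ZornsLemma : ∀ a ℓ₁ ℓ₂ p → Set (suc (a ⊔ ℓ₁ ⊔ ℓ₂ ⊔ p))
ZornsLemma a ℓ₁ ℓ₂ p = (P : Poset a ℓ₁ ℓ₂) → let open Poset P in
  ((C : Pred Carrier p) →
    (∀ {x y} → C x → C y → x ≤ y ⊎ y ≤ x) →
    ∃ λ u → ∀ {x} → C x → x ≤ u) →
  ∃ λ m → ∀ x → m ≤ x → x ≈ m

{-# OPTIONS --safe #-}
-- By C8, x ⇒ y = ∼ x ⊕ y satisfies x ⇒ y ≤ κ x ⇒ κ y, so the congruence of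
-- every filter of the underlying MV-algebra respects κ.  For e ≠ 1, Zorn's lemma
-- gives a filter F maximal among those avoiding e.  If p ∨ q = 1, then
-- { u | u ∨ q ∈ F } is a filter containing F and p, and { u | u ∨ e ∈ F } is a
-- filter containing F and avoiding e.  Maximality applied to both of them yields
-- p ∈ F or q ∈ F.  With p = x ⇒ y and q = y ⇒ x this makes the quotient by F a
-- chain, in which e is not identified with 1.
module Submission where

open import Level using (_⊔_; Lift; lift; lower) renaming (suc to lsuc)
open import Algebra.Bundles using (CommutativeMonoid)
import Algebra.Properties.CommutativeSemigroup as CommutativeSemigroupProperties
open import Axiom.DoubleNegationElimination using (em⇒dne)
open import Axiom.ExcludedMiddle using (ExcludedMiddle)
open import Data.Product using (Σ; ∃; _×_; _,_; proj₁; proj₂)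
open import Data.Sum as Sum using (_⊎_; inj₁; inj₂)
open import Relation.Binary.Bundles using (Poset; Setoid)
import Relation.Binary.Construct.On as On
import Relation.Binary.Reasoning.Setoid as SetoidReasoning
open import Relation.Binary.Structures using (IsEquivalence)
open import Relation.Nullary using (¬_; yes; no)
open import Relation.Nullary.Decidable using (True; toWitness; fromWitness)
open import Relation.Unary using (Pred; _∈_; _∉_; _⊆_)
open import Relation.Unary.Relation.Binary.Subset using (⊆-poset)
open import Defs

-- MV-algebra arithmetic in terms of implication and join.

module Arithmetic {c ℓ} (𝓐 : ContinuousAlgebra c ℓ) where
  open ContinuousAlgebra 𝓐 public
  open IsEquivalence isEquivalence public using (refl; sym; trans)

  setoid : Setoid c ℓ
  setoid = record { isEquivalence = isEquivalence }

  open SetoidReasoning setoid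

  ⊕-identityˡ : ∀ x → 0# ⊕ x ≈ x
  ⊕-identityˡ x = trans (C2 0# x) (C3 x)

  ⊕-0-commutativeMonoid : CommutativeMonoid c ℓ
  ⊕-0-commutativeMonoid = record
    { isCommutativeMonoid = record
      { isMonoid = record
        { isSemigroup = record
          { isMagma = record { isEquivalence = isEquivalence ; ∙-cong = ⊕-cong }
          ; assoc   = λ x y z → sym (C1 x y z)
          }
        ; identity = ⊕-identityˡ , C3
        }
      ; comm = C2
      }
    }

  open CommutativeSemigroupProperties
    (CommutativeMonoid.commutativeSemigroup ⊕-0-commutativeMonoid)
    using (x∙yz≈y∙xz)

  infixr 5 _⇒_
  infixr 5 _∨_

  _⇒_ : Carrier → Carrier → Carrier
  x ⇒ y = ∼ x ⊕ y

  -- The lattice join of an MV-algebra; C6 is exactly its commutativity.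
  _∨_ : Carrier → Carrier → Carrier
  x ∨ y = (x ⇒ y) ⇒ y

  ⇒-cong : ∀ {x x′ y y′} → x ≈ x′ → y ≈ y′ → x ⇒ y ≈ x′ ⇒ y′
  ⇒-cong p q = ⊕-cong (∼-cong p) q

  ⇒-congˡ : ∀ {x y y′} → y ≈ y′ → x ⇒ y ≈ x ⇒ y′
  ⇒-congˡ = ⇒-cong refl

  ⇒-congʳ : ∀ {x x′ y} → x ≈ x′ → x ⇒ y ≈ x′ ⇒ y
  ⇒-congʳ p = ⇒-cong p refl

  1⇒x≈x : ∀ x → 1# ⇒ x ≈ x
  1⇒x≈x x = trans (⊕-cong (C4 0#) refl) (⊕-identityˡ x)

  x⇒1≈1 : ∀ x → x ⇒ 1# ≈ 1#
  x⇒1≈1 x = C5 (∼ x)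

  ≤-refl : ∀ {x} → x ≤ x
  ≤-refl {x} = begin
    x ⇒ x           ≈⟨ ⇒-congʳ (1⇒x≈x x) ⟨
    (1# ⇒ x) ⇒ x    ≈⟨ C6 1# x ⟩
    (x ⇒ 1#) ⇒ 1#   ≈⟨ x⇒1≈1 (x ⇒ 1#) ⟩
    1#              ∎

  ≤-reflexive : ∀ {x y} → x ≈ y → x ≤ y
  ≤-reflexive x≈y = trans (⇒-congˡ (sym x≈y)) ≤-refl

  ≤-antisym : ∀ {x y} → x ≤ y → y ≤ x → x ≈ y
  ≤-antisym {x} {y} x≤y y≤x = begin
    x              ≈⟨ 1⇒x≈x x ⟨
    1# ⇒ x         ≈⟨ ⇒-congʳ y≤x ⟨
    (y ⇒ x) ⇒ x    ≈⟨ C6 y x ⟩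
    (x ⇒ y) ⇒ y    ≈⟨ ⇒-congʳ x≤y ⟩
    1# ⇒ y         ≈⟨ 1⇒x≈x y ⟩
    y              ∎

  ⇒-exchange : ∀ x y z → x ⇒ (y ⇒ z) ≈ y ⇒ (x ⇒ z)
  ⇒-exchange x y z = x∙yz≈y∙xz (∼ x) (∼ y) z

  ⇒-contrapositive : ∀ x y → x ⇒ y ≈ ∼ y ⇒ ∼ x
  ⇒-contrapositive x y = trans (C2 (∼ x) y) (⊕-cong (sym (C4 y)) refl)

  y≤x⇒y : ∀ x y → y ≤ x ⇒ y
  y≤x⇒y x y = begin
    y ⇒ (x ⇒ y)   ≈⟨ ⇒-exchange y x y ⟩
    x ⇒ (y ⇒ y)   ≈⟨ ⇒-congˡ ≤-refl ⟩
    x ⇒ 1#        ≈⟨ x⇒1≈1 x ⟩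
    1#            ∎

  ∨-comm : ∀ x y → x ∨ y ≈ y ∨ x
  ∨-comm = C6

  x≤x∨y : ∀ x y → x ≤ x ∨ y
  x≤x∨y x y = trans (⇒-exchange x (x ⇒ y) y) ≤-refl

  y≤x∨y : ∀ x y → y ≤ x ∨ y
  y≤x∨y x y = y≤x⇒y (x ⇒ y) y

  x≤y⇒x∨y≈y : ∀ {x y} → x ≤ y → x ∨ y ≈ y
  x≤y⇒x∨y≈y {y = y} x≤y = trans (⇒-congʳ x≤y) (1⇒x≈x y)

  ∨-idem : ∀ x → x ∨ x ≈ x
  ∨-idem x = x≤y⇒x∨y≈y ≤-refl

  -- Exchange exposes `y ∨ z` under `x`; commuting the join and exchanging back leaves an instance
  -- of weakening.
  ⇒-suffixing : ∀ x y z → x ⇒ y ≤ (y ⇒ z) ⇒ (x ⇒ z)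
  ⇒-suffixing x y z = begin
    (x ⇒ y) ⇒ (y ⇒ z) ⇒ (x ⇒ z)   ≈⟨ ⇒-congˡ (⇒-exchange (y ⇒ z) x z) ⟩
    (x ⇒ y) ⇒ (x ⇒ (y ∨ z))       ≈⟨ ⇒-congˡ (⇒-congˡ (∨-comm y z)) ⟩
    (x ⇒ y) ⇒ (x ⇒ (z ∨ y))       ≈⟨ ⇒-congˡ (⇒-exchange x (z ⇒ y) y) ⟩
    (x ⇒ y) ⇒ (z ⇒ y) ⇒ (x ⇒ y)   ≈⟨ y≤x⇒y (z ⇒ y) (x ⇒ y) ⟩
    1#                            ∎

  ≤-trans : ∀ {x y z} → x ≤ y → y ≤ z → x ≤ z
  ≤-trans {x} {y} {z} x≤y y≤z = begin
    x ⇒ z                           ≈⟨ 1⇒x≈x (x ⇒ z) ⟨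
    1# ⇒ (x ⇒ z)                    ≈⟨ ⇒-congʳ y≤z ⟨
    (y ⇒ z) ⇒ (x ⇒ z)               ≈⟨ 1⇒x≈x _ ⟨
    1# ⇒ (y ⇒ z) ⇒ (x ⇒ z)          ≈⟨ ⇒-congʳ x≤y ⟨
    (x ⇒ y) ⇒ (y ⇒ z) ⇒ (x ⇒ z)     ≈⟨ ⇒-suffixing x y z ⟩
    1#                              ∎

  -- Suffixing reverses an implication, so applying it twice restores the direction.
  ⇒-mono-∨ : ∀ x y z → x ⇒ y ≤ (x ∨ z) ⇒ (y ∨ z)
  ⇒-mono-∨ x y z = ≤-trans (⇒-suffixing x y z) (⇒-suffixing (y ⇒ z) (x ⇒ z) z)

  ∨-least : ∀ {x y z} → x ≤ z → y ≤ z → x ∨ y ≤ z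
  ∨-least {x} {y} {z} x≤z y≤z = begin
    (x ∨ y) ⇒ z                   ≈⟨ ⇒-congˡ (x≤y⇒x∨y≈y y≤z) ⟨
    (x ∨ y) ⇒ (y ∨ z)             ≈⟨ ⇒-congˡ (∨-comm y z) ⟩
    (x ∨ y) ⇒ (z ∨ y)             ≈⟨ 1⇒x≈x _ ⟨
    1# ⇒ (x ∨ y) ⇒ (z ∨ y)        ≈⟨ ⇒-congʳ x≤z ⟨
    (x ⇒ z) ⇒ (x ∨ y) ⇒ (z ∨ y)   ≈⟨ ⇒-mono-∨ x z y ⟩
    1#                            ∎

  -- Needed for closure of residual filters under modus ponens.
  ∨-distrib-⇒ : ∀ x y z → (x ⇒ y) ∨ z ≤ (x ∨ z) ⇒ (y ∨ z)
  ∨-distrib-⇒ x y z = ∨-least (⇒-mono-∨ x y z)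
    (≤-trans (y≤x∨y y z) (y≤x⇒y (x ∨ z) (y ∨ z)))

  -- The left side unfolds to `(x ⇒ y) ∨ y`, and `y` lies below `x ⇒ y`.
  [x∨y]⇒y≈x⇒y : ∀ x y → (x ∨ y) ⇒ y ≈ x ⇒ y
  [x∨y]⇒y≈x⇒y x y = trans (∨-comm (x ⇒ y) y) (x≤y⇒x∨y≈y (y≤x⇒y x y))

  -- The dual form of s ∧ x = x.
  x≤s⇒[s⇒x]⇒∼s≈∼x : ∀ {x s} → x ≤ s → (s ⇒ x) ⇒ ∼ s ≈ ∼ x
  x≤s⇒[s⇒x]⇒∼s≈∼x {x} {s} x≤s = begin
    (s ⇒ x) ⇒ ∼ s       ≈⟨ ⇒-congʳ (⇒-contrapositive s x) ⟩
    ∼ x ∨ ∼ s           ≈⟨ ∨-comm (∼ x) (∼ s) ⟩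
    ∼ s ∨ ∼ x           ≈⟨ x≤y⇒x∨y≈y (trans (sym (⇒-contrapositive x s)) x≤s) ⟩
    ∼ x                 ∎

  x≤s⇒[s⇒x]⇒s⇒y≈x⇒y : ∀ {x s} y → x ≤ s → (s ⇒ x) ⇒ (s ⇒ y) ≈ x ⇒ y
  x≤s⇒[s⇒x]⇒s⇒y≈x⇒y y x≤s = trans (C1 _ _ y) (⊕-cong (x≤s⇒[s⇒x]⇒∼s≈∼x x≤s) refl)

  -- With s = x ∨ y the two implications are s ⇒ y and s ⇒ x, and
  -- (s ⇒ x) ⇒ (s ⇒ y) = (s ∧ x) ⇒ y = x ⇒ y.
  prelinearity : ∀ x y → (x ⇒ y) ∨ (y ⇒ x) ≈ 1#
  prelinearity x y = begin
    (x ⇒ y) ∨ (y ⇒ x)                   ≈⟨ ∨-comm (x ⇒ y) (y ⇒ x) ⟩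
    ((y ⇒ x) ⇒ (x ⇒ y)) ⇒ (x ⇒ y)       ≈⟨ ⇒-congʳ (⇒-cong s⇒x ([x∨y]⇒y≈x⇒y x y)) ⟨
    ((s ⇒ x) ⇒ (s ⇒ y)) ⇒ (x ⇒ y)       ≈⟨ ⇒-congʳ (x≤s⇒[s⇒x]⇒s⇒y≈x⇒y y (x≤x∨y x y)) ⟩
    (x ⇒ y) ⇒ (x ⇒ y)                   ≈⟨ ≤-refl ⟩
    1#                                  ∎
    where
    s = x ∨ y
    s⇒x : s ⇒ x ≈ y ⇒ x
    s⇒x = trans (⇒-congʳ (∨-comm x y)) ([x∨y]⇒y≈x⇒y y x)

  -- Up to double negation `x ⊕ y` is `∼ x ⇒ y`, so this is suffixing applied to the contrapositive.
  ⊕-suffixing : ∀ x x′ y → x ⇒ x′ ≤ (x ⊕ y) ⇒ (x′ ⊕ y)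
  ⊕-suffixing x x′ y = trans
    (⇒-cong (⇒-contrapositive x x′)
      (⇒-cong (⊕-cong (sym (C4 x)) refl) (⊕-cong (sym (C4 x′)) refl)))
    (⇒-suffixing (∼ x′) (∼ x) y)

  ⇒-κ : ∀ x y → x ⇒ y ≤ κ x ⇒ κ y
  ⇒-κ x y = trans (C2 _ _) (C8 x y)

  0≈1⇒trivial : 0# ≈ 1# → ∀ x y → x ≈ y
  0≈1⇒trivial 0≈1 x y = trans (x≈1 x) (sym (x≈1 y))
    where
    x≈1 : ∀ x → x ≈ 1#
    x≈1 x = trans (sym (C3 x)) (trans (⊕-cong refl 0≈1) (C5 x))

-- Filters and their quotients.

module Filters {c ℓ} (𝓐 : ContinuousAlgebra c ℓ) where
  open Arithmetic 𝓐

  -- Filters as deductive systems. Admitting everything equal to `1#`, not just `1#` itself, makes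
  -- respect for `_≈_` derivable.
  record IsFilter {p} (F : Pred Carrier p) : Set (c ⊔ ℓ ⊔ p) where
    field
      ≈1⇒∈ : ∀ {x} → x ≈ 1# → x ∈ F
      mp   : ∀ {x y} → x ⇒ y ∈ F → x ∈ F → y ∈ F

    upward : ∀ {x y} → x ≤ y → x ∈ F → y ∈ F
    upward x≤y = mp (≈1⇒∈ x≤y)

    resp : ∀ {x y} → x ≈ y → x ∈ F → y ∈ F
    resp x≈y = upward (≤-reflexive x≈y)

  module Quotient {F : Pred Carrier ℓ} (isFilter : IsFilter F) where
    open IsFilter isFilter

    infix 4 _≈F_
    _≈F_ : Carrier → Carrier → Set ℓ
    x ≈F y = x ⇒ y ∈ F × y ⇒ x ∈ F

    ≈⇒≈F : ∀ {x y} → x ≈ y → x ≈F y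
    ≈⇒≈F x≈y = ≈1⇒∈ (≤-reflexive x≈y) , ≈1⇒∈ (≤-reflexive (sym x≈y))

    ≈F-trans : ∀ {x y z} → x ≈F y → y ≈F z → x ≈F z
    ≈F-trans (xy , yx) (yz , zy) =
      mp (upward (⇒-suffixing _ _ _) xy) yz , mp (upward (⇒-suffixing _ _ _) zy) yx

    ⊕-congˡF : ∀ {x x′} y → x ≈F x′ → x ⊕ y ≈F x′ ⊕ y
    ⊕-congˡF y (p , q) = upward (⊕-suffixing _ _ y) p , upward (⊕-suffixing _ _ y) q

    ≈F1⇒∈ : ∀ {x} → x ≈F 1# → x ∈ F
    ≈F1⇒∈ {x} (_ , 1⇒x∈F) = resp (1⇒x≈x x) 1⇒x∈F

    ∈⇒≈F1 : ∀ {x} → x ∈ F → x ≈F 1#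
    ∈⇒≈F1 {x} x∈F = ≈1⇒∈ (x⇒1≈1 x) , resp (sym (1⇒x≈x x)) x∈F

    -- Only the equality is coarsened, so every axiom is inherited through `≈⇒≈F`.
    quotient : ContinuousAlgebra c ℓ
    quotient = record
      { Carrier       = Carrier
      ; _≈_           = _≈F_
      ; _⊕_           = _⊕_
      ; ∼_            = ∼_
      ; 0#            = 0#
      ; κ             = κ
      ; isEquivalence = record
        { refl  = ≈⇒≈F refl
        ; sym   = λ (p , q) → q , p
        ; trans = ≈F-trans
        }
      -- `⊕-congˡF` replaces a left summand only; the right one is commuted to the left and back.
      ; ⊕-cong        = λ {x} {x′} {y} {y′} p q → ≈F-trans (⊕-congˡF y p)
          (≈F-trans (≈⇒≈F (C2 x′ y)) (≈F-trans (⊕-congˡF x′ q) (≈⇒≈F (C2 y′ x′))))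
      ; ∼-cong        = λ (p , q) →
          resp (⇒-contrapositive _ _) q , resp (⇒-contrapositive _ _) p
      ; κ-cong        = λ (p , q) → upward (⇒-κ _ _) p , upward (⇒-κ _ _) q
      ; C1            = λ x y z → ≈⇒≈F (C1 x y z)
      ; C2            = λ x y → ≈⇒≈F (C2 x y)
      ; C3            = λ x → ≈⇒≈F (C3 x)
      ; C4            = λ x → ≈⇒≈F (C4 x)
      ; C5            = λ x → ≈⇒≈F (C5 x)
      ; C6            = λ x y → ≈⇒≈F (C6 x y)
      ; C7            = λ x → ≈⇒≈F (C7 x)
      ; C8            = λ x y → ≈⇒≈F (C8 x y)
      }

    -- The quotient order `x ≤ y` amounts to `x ⇒ y ∈ F`.
    prime⇒isChain : (∀ x y → x ⇒ y ∈ F ⊎ y ⇒ x ∈ F) → IsChain quotient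
    prime⇒isChain prime = record
      { isPartialOrder = record
        { isPreorder = record
          { isEquivalence = Q.isEquivalence
          ; reflexive     = λ (p , _) → ∈⇒≈F1 p
          ; trans         = λ p q → ∈⇒≈F1
              (mp (upward (⇒-suffixing _ _ _) (≈F1⇒∈ p)) (≈F1⇒∈ q))
          }
        ; antisym = λ p q → ≈F1⇒∈ p , ≈F1⇒∈ q
        }
      ; total = λ x y → Sum.map ∈⇒≈F1 ∈⇒≈F1 (prime x y)
      }
      where module Q = ContinuousAlgebra quotient

  -- Residual filters, maximal filters and primeness.

  residual : ∀ {p} → Pred Carrier p → Carrier → Pred Carrier p
  residual F q u = u ∨ q ∈ F

  module _ {p} {F : Pred Carrier p} (isFilter : IsFilter F) where
    open IsFilter isFilter

    residual-isFilter : ∀ q → IsFilter (residual F q)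
    residual-isFilter q = record
      { ≈1⇒∈ = λ x≈1 → upward (x≤x∨y _ q) (≈1⇒∈ x≈1)
      ; mp   = λ p → mp (upward (∨-distrib-⇒ _ _ q) p)
      }

    ⊆-residual : ∀ q → F ⊆ residual F q
    ⊆-residual q = upward (x≤x∨y _ q)

  record FilterAvoiding (e : Carrier) : Set (c ⊔ lsuc ℓ) where
    field
      carrier  : Pred Carrier ℓ
      isFilter : IsFilter carrier
      avoids   : e ∉ carrier

  open FilterAvoiding

  filterPoset : Carrier → Poset (c ⊔ lsuc ℓ) (c ⊔ ℓ) (c ⊔ ℓ)
  filterPoset e = On.poset (⊆-poset Carrier ℓ) (carrier {e})

  IsMaximal : ∀ {e} → FilterAvoiding e → Set (c ⊔ lsuc ℓ)
  IsMaximal {e} F = (G : FilterAvoiding e) → carrier F ⊆ carrier G → carrier G ⊆ carrier F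

  module _ (em : ∀ p → ExcludedMiddle p) where

    -- The residual at `q` always contains `p`, but avoids `e` only if `e ∨ q ∉ F`. Otherwise `q`
    -- lies in the residual at `e`, which avoids `e` because `e ∨ e ≈ e`.
    maximal⇒prime : ∀ {e} (F : FilterAvoiding e) → IsMaximal F →
      ∀ {p q} → p ∨ q ≈ 1# → p ∈ carrier F ⊎ q ∈ carrier F
    maximal⇒prime {e} F maximal {p} {q} p∨q≈1 with em ℓ {residual (carrier F) q e}
    ... | no e∨q∉F = inj₁ (maximal
          (record { isFilter = residual-isFilter (isFilter F) q ; avoids = e∨q∉F })
          (⊆-residual (isFilter F) q) (≈1⇒∈ p∨q≈1))
      where open IsFilter (isFilter F)
    ... | yes e∨q∈F = inj₂ (maximal
          (record { isFilter = residual-isFilter (isFilter F) e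
                  ; avoids   = λ e∨e∈F → avoids F (resp (∨-idem e) e∨e∈F) })
          (⊆-residual (isFilter F) e) (resp (∨-comm e q) e∨q∈F))
      where open IsFilter (isFilter F)

    -- The union of a chain quantifies over filters, hence lives above level ℓ;
    -- excluded middle brings it back down.
    Resize : ∀ {a} → Set a → Set ℓ
    Resize {a} P = Lift ℓ (True (em a {P}))

    resize : ∀ {a} {P : Set a} → P → Resize P
    resize p = lift (fromWitness p)

    unresize : ∀ {a} {P : Set a} → Resize P → P
    unresize r = toWitness (lower r)

    module _ {e : Carrier} (e≉1 : ¬ e ≈ 1#) {p} (C : Pred (FilterAvoiding e) p)
             (chain : ∀ {F G} → C F → C G →
                      carrier F ⊆ carrier G ⊎ carrier G ⊆ carrier F) where

      -- The first summand makes this a filter for the empty chain too.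
      ⋃ : Pred Carrier (c ⊔ lsuc ℓ ⊔ p)
      ⋃ x = x ≈ 1# ⊎ ∃ λ F → C F × x ∈ carrier F

      ⋃-isFilter : IsFilter ⋃
      ⋃-isFilter = record { ≈1⇒∈ = inj₁ ; mp = mp-⋃ }
        where
        mp-⋃ : ∀ {x y} → x ⇒ y ∈ ⋃ → x ∈ ⋃ → y ∈ ⋃
        mp-⋃ {x} {y} (inj₁ x≤y) (inj₁ x≈1) =
          inj₁ (trans (sym (1⇒x≈x y)) (trans (⇒-congʳ (sym x≈1)) x≤y))
        mp-⋃ (inj₁ x≤y) (inj₂ (F , F∈C , x∈F)) =
          inj₂ (F , F∈C , IsFilter.upward (isFilter F) x≤y x∈F)
        mp-⋃ (inj₂ (F , F∈C , x⇒y∈F)) (inj₁ x≈1) =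
          inj₂ (F , F∈C , mp x⇒y∈F (≈1⇒∈ x≈1))
          where open IsFilter (isFilter F)
        -- The premises may come from different filters; the larger one contains both.
        mp-⋃ (inj₂ (F , F∈C , x⇒y∈F)) (inj₂ (G , G∈C , x∈G)) with chain F∈C G∈C
        ... | inj₁ F⊆G = inj₂ (G , G∈C , IsFilter.mp (isFilter G) (F⊆G x⇒y∈F) x∈G)
        ... | inj₂ G⊆F = inj₂ (F , F∈C , IsFilter.mp (isFilter F) x⇒y∈F (G⊆F x∈G))

      e∉⋃ : e ∉ ⋃
      e∉⋃ (inj₁ e≈1)           = e≉1 e≈1
      e∉⋃ (inj₂ (F , _ , e∈F)) = avoids F e∈F

      chain-upperBound : ∃ λ U → ∀ {F} → C F → carrier F ⊆ carrier U
      chain-upperBound =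
        record
          { carrier  = λ x → Resize (⋃ x)
          ; isFilter = record
            { ≈1⇒∈ = λ x≈1 → resize (≈1⇒∈ x≈1)
            ; mp   = λ p q → resize (mp (unresize p) (unresize q))
            }
          ; avoids   = λ e∈⋃ → e∉⋃ (unresize e∈⋃)
          }
        , λ F∈C x∈F → resize (inj₂ (_ , F∈C , x∈F))
        where open IsFilter ⋃-isFilter

    maximalFilter : (∀ a ℓ₁ ℓ₂ p → ZornsLemma a ℓ₁ ℓ₂ p) →
      ∀ {e} → ¬ e ≈ 1# → Σ (FilterAvoiding e) IsMaximal
    maximalFilter zorn {e} e≉1 with zorn _ _ _ ℓ (filterPoset e) (chain-upperBound e≉1)
    ... | F , maximal = F , λ G F⊆G → proj₁ (maximal G F⊆G)

-- Subdirect representation.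

theorem3p1 : (∀ p → ExcludedMiddle p) →
    (∀ a ℓ₁ ℓ₂ p → ZornsLemma a ℓ₁ ℓ₂ p) →
    ∀ {c ℓ} (𝓐 : ContinuousAlgebra c ℓ) → NonTrivial 𝓐 →
    Σ (Set (c ⊔ ℓ)) λ I → Σ (I → ContinuousAlgebra c ℓ) λ 𝓑 →
    (∀ i → IsChain (𝓑 i)) × IsSubdirectProduct 𝓐 𝓑
theorem3p1 em zorn {c} {ℓ} 𝓐 (a , b , a≉b) = I , 𝓑 , 𝓑-isChain , record
  -- `0#` is a valid index, since `0# ≈ 1#` would identify `a` with `b`.
  { nonEmpty       = 0# , λ 0≈1 → a≉b (0≈1⇒trivial 0≈1 a b)
  -- All factors share the carrier of `𝓐`, so the diagonal map serves and its projections are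
  -- identities.
  ; h              = λ x i → x
  ; isHomomorphism = record
    { cong   = λ x≈y i → Q.≈⇒≈F i x≈y
    ; 0-homo = λ i → Q.≈⇒≈F i refl
    ; ⊕-homo = λ x y i → Q.≈⇒≈F i refl
    ; ∼-homo = λ x i → Q.≈⇒≈F i refl
    ; κ-homo = λ x i → Q.≈⇒≈F i refl
    }
  ; injective      = λ x≈y → ≤-antisym
      (∈-all⇒≈1 (λ i → proj₁ (x≈y i))) (∈-all⇒≈1 (λ i → proj₂ (x≈y i)))
  ; surjective     = λ i y → y , Q.≈⇒≈F i
  }
  where
  open Arithmetic 𝓐
  open Filters 𝓐
  open FilterAvoiding

  I : Set (c ⊔ ℓ)
  I = ∃ λ e → ¬ e ≈ 1#

  F : (i : I) → FilterAvoiding (proj₁ i)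
  F (e , e≉1) = proj₁ (maximalFilter em zorn e≉1)

  module Q (i : I) = Quotient (isFilter (F i))

  𝓑 : I → ContinuousAlgebra c ℓ
  𝓑 = Q.quotient

  𝓑-isChain : ∀ i → IsChain (𝓑 i)
  𝓑-isChain i@(e , e≉1) = Q.prime⇒isChain i λ x y →
    maximal⇒prime em (F i) (proj₂ (maximalFilter em zorn e≉1)) (prelinearity x y)

  -- An `x` different from `1#` is itself an index, and the filter chosen there avoids `x`.
  ∈-all⇒≈1 : ∀ {x} → (∀ i → x ∈ carrier (F i)) → x ≈ 1#
  ∈-all⇒≈1 {x} x∈F = em⇒dne (em ℓ) λ x≉1 → avoids (F (x , x≉1)) (x∈F (x , x≉1))
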